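{- For all graphs $G$ and $H$, \[\bar{\vartheta}(G \,\square\, H) = \max\{\bar{\vartheta}(G), \bar{\vartheta}(H)\}.\]
   Context: Graphs are finite, simple and undirected. The Cartesian product $G \,\square\, H$ has vertex set $V(G)\times V(H)$, with $(u_1,v_1)\sim(u_2,v_2)$ iff ($u_1\sim u_2$ and $v_1=v_2$) or ($u_1=u_2$ and $v_1\sim v_2$). For a real $k>1$, a strict vector $k$-coloring of a graph $G$ is a map $\varphi$ from $V(G)$ to the unit sphere of some $\mathbb{R}^{d}$ such that $\varphi(u)^T\varphi(v) = -\frac{1}{k-1}$ whenever $u\sim v$. The strict vector chromatic number $\bar{\vartheta}(G)$ is the infimum of real $k>1$ such that $G$ admits a strict vector $k$-coloring (this is attained for graphs with at least one edge); equivalently, $\bar{\vartheta}(G)=\vartheta(\overline{G})$, the Lovász theta function of the complement of $G$. -}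

module Defs where

open import Level using (Level; 0ℓ) renaming (_⊔_ to _⊔ˡ_; suc to lsuc)
open import Algebra.Bundles using (CommutativeRing)
open import Algebra.Core using (Op₁; Op₂)
open import Algebra.Structures using (IsCommutativeRing)
import Algebra.Construct.NaturalChoice.Max as Max
import Algebra.Properties.Semiring.Sum as Sum
import Algebra.Solver.Ring.NaturalCoefficients.Default as Solver
open import Data.Empty using (⊥-elim)
open import Data.Fin.Base using (Fin; zero; suc)
open import Data.Fin.Properties using (*↔×)
open import Data.Nat.Base using (ℕ; zero; suc) renaming (_*_ to _*ⁿ_)
open import Data.Product.Base using (Σ-syntax; ∃; ∃-syntax; _×_; _,_; proj₁; proj₂)
open import Data.Product.Function.NonDependent.Propositional using (_×-↔_)
open import Data.Sum.Base using (_⊎_; inj₁; inj₂)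
open import Data.Vec.Functional using (Vector; zipWith)
open import Function.Base using (_∘_)
open import Function.Bundles using (_↔_; module Inverse; module Injection)
open import Function.Construct.Composition using (_↔-∘_)
open import Function.Construct.Symmetry using (↔-sym)
open import Function.Properties.Inverse using (↔⇒↣)
open import Relation.Binary.Bundles using (DecTotalOrder; TotalOrder)
open import Relation.Binary.Core using (Rel)
open import Relation.Binary.Definitions using (Symmetric; Irreflexive)
import Relation.Binary.Construct.NonStrictToStrict as NonStrictToStrict
open import Relation.Binary.PropositionalEquality.Core as ≡ using (_≡_; _≢_)
import Relation.Binary.Reasoning.Setoid as SetoidReasoning
open import Relation.Binary.Structures using (IsDecTotalOrder)
open import Relation.Nullary.Negation using (¬_)
open import Relation.Unary using (Pred; _∈_)

-- Graphs have at least one vertex.  The null graph has a strict vector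
-- k-coloring for every k > 1, and it annihilates □, so with it the value of
-- G □ H would be 1 whatever the value of the other factor.

record Graph : Set₁ where
  field
    V        : Set
    order    : ℕ
    finite   : V ↔ Fin order
    vertex   : V
    _~_      : Rel V 0ℓ
    ~-sym    : Symmetric _~_
    ~-irrefl : Irreflexive _≡_ _~_

infixr 7 _□_

_□_ : Graph → Graph → Graph
G □ H = record
  { V       = G.V × H.V
  ; order   = G.order *ⁿ H.order
  ; finite  = ↔-sym *↔× ↔-∘ (G.finite ×-↔ H.finite)
  ; vertex  = G.vertex , H.vertex
  ; _~_     = λ (u₁ , v₁) (u₂ , v₂) →
                ((u₁ G.~ u₂) × (v₁ ≡ v₂)) ⊎ ((u₁ ≡ u₂) × (v₁ H.~ v₂))
  ; ~-sym   = λ where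
      (inj₁ (e , p)) → inj₁ (G.~-sym e , ≡.sym p)
      (inj₂ (p , e)) → inj₂ (≡.sym p , H.~-sym e)
  ; ~-irrefl = λ where
      ≡.refl (inj₁ (e , _)) → G.~-irrefl ≡.refl e
      ≡.refl (inj₂ (_ , e)) → H.~-irrefl ≡.refl e
  }
  where
  module G = Graph G
  module H = Graph H

module Bounds {c ℓ} {A : Set c} (_≤_ : Rel A ℓ) where

  IsUpperBound IsLowerBound IsSupremum IsInfimum :
    ∀ {p} → Pred A p → A → Set (c ⊔ˡ ℓ ⊔ˡ p)
  IsUpperBound S b = ∀ {x} → x ∈ S → x ≤ b
  IsLowerBound S b = ∀ {x} → x ∈ S → b ≤ x
  IsSupremum   S s = IsUpperBound S s × (∀ {b} → IsUpperBound S b → s ≤ b)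
  IsInfimum    S s = IsLowerBound S s × (∀ {b} → IsLowerBound S b → b ≤ s)

-- The classical axioms of the real numbers, which determine them up to
-- isomorphism.  Completeness for arbitrary predicates and decidability of the
-- order are read classically: a model can be built from excluded middle, but
-- not without some non-constructive principle.

record CompleteOrderedField (c ℓ₁ ℓ₂ : Level) : Set (lsuc (c ⊔ˡ ℓ₁ ⊔ˡ ℓ₂)) where
  infix  9 _⁻¹
  infix  8 -_
  infixl 7 _*_
  infixl 6 _+_ _-_
  infix  4 _≈_ _≤_
  field
    Carrier : Set c
    _≈_     : Rel Carrier ℓ₁
    _≤_     : Rel Carrier ℓ₂
    _+_     : Op₂ Carrier
    _*_     : Op₂ Carrier
    -_      : Op₁ Carrier
    _⁻¹     : Op₁ Carrier
    0#      : Carrier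
    1#      : Carrier

    isCommutativeRing : IsCommutativeRing _≈_ _+_ _*_ -_ 0# 1#
    isDecTotalOrder   : IsDecTotalOrder _≈_ _≤_

    0≉1      : ¬ (0# ≈ 1#)
    -- Nothing is assumed about 0# ⁻¹.
    ⁻¹-inverseʳ : ∀ {x} → ¬ (x ≈ 0#) → x * x ⁻¹ ≈ 1#

    +-monoʳ-≤ : ∀ z {x y} → x ≤ y → z + x ≤ z + y
    *-nonneg  : ∀ {x y} → 0# ≤ x → 0# ≤ y → 0# ≤ x * y

  open Bounds _≤_ public

  field
    complete : (S : Pred Carrier (c ⊔ˡ ℓ₁ ⊔ˡ ℓ₂)) →
               ∃ S → ∃ (IsUpperBound S) → ∃ (IsSupremum S)

  commutativeRing : CommutativeRing c ℓ₁
  commutativeRing = record { isCommutativeRing = isCommutativeRing }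

  decTotalOrder : DecTotalOrder c ℓ₁ ℓ₂
  decTotalOrder = record { isDecTotalOrder = isDecTotalOrder }

  totalOrder : TotalOrder c ℓ₁ ℓ₂
  totalOrder = DecTotalOrder.totalOrder decTotalOrder

  open NonStrictToStrict _≈_ _≤_ public using (_<_)
  open Max totalOrder public using (_⊔_)

  _-_ : Op₂ Carrier
  x - y = x + - y

  infimum : (S : Pred Carrier (c ⊔ˡ ℓ₁ ⊔ˡ ℓ₂)) →
            ∃ S → ∃ (IsLowerBound S) → ∃ (IsInfimum S)
  infimum S (k , k∈S) below with complete (IsLowerBound S) below (k , λ lb → lb k∈S)
  ... | s , upper , least = s , (λ x∈S → least (λ lb → lb x∈S)) , λ lb → upper lb

module Theta {c ℓ₁ ℓ₂} (ℝ : CompleteOrderedField c ℓ₁ ℓ₂) where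

  open CompleteOrderedField ℝ
  open Sum (CommutativeRing.semiring commutativeRing) using (sum)

  infixl 7 _·_

  _·_ : ∀ {d} → Vector Carrier d → Vector Carrier d → Carrier
  x · y = sum (zipWith _*_ x y)

  record IsStrictVectorColoring (k : Carrier) (G : Graph) {d : ℕ}
           (φ : Graph.V G → Vector Carrier d) : Set ℓ₁ where
    open Graph G
    field
      unit : ∀ u → φ u · φ u ≈ 1#
      edge : ∀ {u v} → u ~ v → φ u · φ v ≈ - (k - 1#) ⁻¹

  StrictVectorColorable : Graph → Pred Carrier (c ⊔ˡ ℓ₁ ⊔ˡ ℓ₂)
  StrictVectorColorable G k =
    (1# < k) ×
    (∃[ d ] Σ[ φ ∈ (Graph.V G → Vector Carrier d) ] IsStrictVectorColoring k G φ)

  -- The infimum is over a nonempty set: on n = 1 + m points, the vectors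
  -- ((4m + 3) eᵢ - 4 (e₁ + … + eₙ)) / (4m + 1) of ℝⁿ have norm 1 and
  -- pairwise inner product - (16m + 8) / (4m + 1)².

  private
    module R = CommutativeRing commutativeRing
    module O = DecTotalOrder decTotalOrder
    open Sum R.semiring using (sum-cong-≋; ∑-distrib-+; *-distribˡ-sum)
    open Solver R.commutativeSemiring using (solve; con; _:=_; _:+_; _:*_)
    open SetoidReasoning R.setoid

    _×1 : ℕ → Carrier
    n ×1 = sum {n} (λ _ → 1#)

    δ : ∀ {n} → Fin n → Fin n → Carrier
    δ zero    zero    = 1#
    δ zero    (suc _) = 0#
    δ (suc _) zero    = 0#
    δ (suc i) (suc j) = δ i j

    δ-refl : ∀ {n} (i : Fin n) → δ i i ≈ 1#
    δ-refl zero    = R.refl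
    δ-refl (suc i) = δ-refl i

    δ-≢ : ∀ {n} (i j : Fin n) → i ≢ j → δ i j ≈ 0#
    δ-≢ zero    zero    i≢j = ⊥-elim (i≢j ≡.refl)
    δ-≢ zero    (suc _) _   = R.refl
    δ-≢ (suc _) zero    _   = R.refl
    δ-≢ (suc i) (suc j) i≢j = δ-≢ i j (i≢j ∘ ≡.cong suc)

    sum-zeroˡ : ∀ {n} (f : Vector Carrier n) → sum (λ a → 0# * f a) ≈ 0#
    sum-zeroˡ f = R.trans (R.sym (*-distribˡ-sum 0# f)) (R.zeroˡ _)

    sum-δ : ∀ {n} (i : Fin n) (f : Vector Carrier n) → sum (λ a → δ i a * f a) ≈ f i
    sum-δ zero f = begin
      1# * f zero + sum (λ a → 0# * f (suc a)) ≈⟨ R.+-cong (R.*-identityˡ _) (sum-zeroˡ (f ∘ suc)) ⟩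
      f zero + 0#                              ≈⟨ R.+-identityʳ _ ⟩
      f zero                                   ∎
    sum-δ (suc i) f = begin
      0# * f zero + sum (λ a → δ i a * f (suc a)) ≈⟨ R.+-cong (R.zeroˡ _) (sum-δ i (f ∘ suc)) ⟩
      0# + f (suc i)                              ≈⟨ R.+-identityˡ _ ⟩
      f (suc i)                                   ∎

    0≤1 : 0# ≤ 1#
    0≤1 with O.total 0# 1#
    ... | inj₁ p = p
    ... | inj₂ p = O.trans (*-nonneg 0≤-1 0≤-1) (O.reflexive eq)
      where
      0≤-1 : 0# ≤ - 1#
      0≤-1 = O.trans (O.reflexive (R.sym (R.-‿inverseˡ 1#)))
               (O.trans (+-monoʳ-≤ (- 1#) p) (O.reflexive (R.+-identityʳ _)))
      eq : - 1# * - 1# ≈ 1#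
      eq = begin
        - 1# * - 1#             ≈⟨ R.+-identityʳ _ ⟨
        - 1# * - 1# + 0#        ≈⟨ R.+-congˡ (R.-‿inverseˡ 1#) ⟨
        - 1# * - 1# + (- 1# + 1#) ≈⟨ solve 1 (λ x → x :* x :+ (x :+ con 1) := x :* (x :+ con 1) :+ con 1) R.refl (- 1#) ⟩
        - 1# * (- 1# + 1#) + 1# ≈⟨ R.+-congʳ (R.*-congˡ (R.-‿inverseˡ 1#)) ⟩
        - 1# * 0# + 1#          ≈⟨ R.+-congʳ (R.zeroʳ _) ⟩
        0# + 1#                 ≈⟨ R.+-identityˡ _ ⟩
        1#                      ∎

    +-nonneg : ∀ {x y} → 0# ≤ x → 0# ≤ y → 0# ≤ x + y
    +-nonneg {x} p q =
      O.trans p (O.trans (O.reflexive (R.sym (R.+-identityʳ x))) (+-monoʳ-≤ x q))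

    ×1-nonneg : ∀ n → 0# ≤ n ×1
    ×1-nonneg zero    = O.refl
    ×1-nonneg (suc n) = +-nonneg 0≤1 (×1-nonneg n)

    1+-nonzero : ∀ {x} → 0# ≤ x → ¬ (1# + x ≈ 0#)
    1+-nonzero {x} p eq = 0≉1 (O.antisym 0≤1
      (O.trans (O.reflexive (R.sym (R.+-identityʳ 1#)))
        (O.trans (+-monoʳ-≤ 1# p) (O.reflexive eq))))

    inverse-nonneg : ∀ {x} → 0# ≤ x → ¬ (x ≈ 0#) → 0# ≤ x ⁻¹
    inverse-nonneg {x} p x≉0 with O.total 0# (x ⁻¹)
    ... | inj₁ q = q
    ... | inj₂ q = ⊥-elim (1+-nonzero 0≤x*-y (begin
            1# + x * - (x ⁻¹)       ≈⟨ R.+-congʳ (⁻¹-inverseʳ x≉0) ⟨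
            x * x ⁻¹ + x * - (x ⁻¹) ≈⟨ R.distribˡ x _ _ ⟨
            x * (x ⁻¹ + - (x ⁻¹))   ≈⟨ R.*-congˡ (R.-‿inverseʳ _) ⟩
            x * 0#                  ≈⟨ R.zeroʳ x ⟩
            0#                      ∎))
      where
      0≤x*-y : 0# ≤ x * - (x ⁻¹)
      0≤x*-y = *-nonneg p (O.trans (O.reflexive (R.sym (R.-‿inverseˡ _)))
                 (O.trans (+-monoʳ-≤ (- (x ⁻¹)) q) (O.reflexive (R.+-identityʳ _))))

    inverse-unique : ∀ {x y} → x * y ≈ 1# → ¬ (x ≈ 0#) → y ≈ x ⁻¹
    inverse-unique {x} {y} xy≈1 x≉0 = begin
      y             ≈⟨ R.*-identityʳ y ⟨
      y * 1#        ≈⟨ R.*-congˡ (⁻¹-inverseʳ x≉0) ⟨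
      y * (x * x ⁻¹) ≈⟨ solve 3 (λ x y z → y :* (x :* z) := (x :* y) :* z) R.refl x y (x ⁻¹) ⟩
      x * y * x ⁻¹  ≈⟨ R.*-congʳ xy≈1 ⟩
      1# * x ⁻¹     ≈⟨ R.*-identityˡ _ ⟩
      x ⁻¹          ∎

    module Simplex (m : ℕ) where

      two four M N S T A D b : Carrier
      two = 1# + 1#
      four = two + two
      M = m ×1
      N = 1# + M
      S = 1# + four * M
      T = 1# + (1# + four * M)
      A = 1# + T
      D = four * T
      b = - four

      four≥0 : 0# ≤ four
      four≥0 = +-nonneg 2≥0 2≥0 where 2≥0 = +-nonneg 0≤1 0≤1

      4M≥0 : 0# ≤ four * M
      4M≥0 = *-nonneg four≥0 (×1-nonneg m)

      S≉0 : ¬ (S ≈ 0#)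
      S≉0 = 1+-nonzero 4M≥0

      D≥0 : 0# ≤ D
      D≥0 = *-nonneg four≥0 (+-nonneg 0≤1 (+-nonneg 0≤1 4M≥0))

      four≉0 : ¬ (four ≈ 0#)
      four≉0 eq = 1+-nonzero (+-nonneg 0≤1 (+-nonneg 0≤1 0≤1))
        (R.trans (solve 0 (con 1 :+ (con 1 :+ (con 1 :+ con 1)) := con 4) R.refl)
          (R.trans (solve 0 (con 4 := (con 1 :+ con 1) :+ (con 1 :+ con 1)) R.refl) eq))

      *-nonzero : ∀ {x y} → ¬ (x ≈ 0#) → ¬ (y ≈ 0#) → ¬ (x * y ≈ 0#)
      *-nonzero {x} {y} x≉0 y≉0 xy≈0 = 0≉1 (begin
        0#                          ≈⟨ R.zeroˡ _ ⟨
        0# * (x ⁻¹ * y ⁻¹)          ≈⟨ R.*-congʳ xy≈0 ⟨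
        x * y * (x ⁻¹ * y ⁻¹)       ≈⟨ solve 4 (λ x y z w → x :* y :* (z :* w) := x :* z :* (y :* w)) R.refl x y _ _ ⟩
        x * x ⁻¹ * (y * y ⁻¹)       ≈⟨ R.*-cong (⁻¹-inverseʳ x≉0) (⁻¹-inverseʳ y≉0) ⟩
        1# * 1#                     ≈⟨ R.*-identityˡ _ ⟩
        1#                          ∎)

      D≉0 : ¬ (D ≈ 0#)
      D≉0 = *-nonzero four≉0 (1+-nonzero (+-nonneg 0≤1 4M≥0))

      r : Carrier
      r = S ⁻¹

      Sr≈1 : S * r ≈ 1#
      Sr≈1 = ⁻¹-inverseʳ S≉0

      k₁ k : Carrier
      k₁ = S * S * D ⁻¹
      k = 1# + k₁

      k₁≉0 : ¬ (k₁ ≈ 0#)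
      k₁≉0 = *-nonzero (*-nonzero S≉0 S≉0) λ D⁻¹≈0 →
        0≉1 (R.trans (R.sym (R.zeroʳ D)) (R.trans (R.*-congˡ (R.sym D⁻¹≈0)) (⁻¹-inverseʳ D≉0)))

      k-1≈k₁ : k - 1# ≈ k₁
      k-1≈k₁ = begin
        1# + k₁ + - 1#   ≈⟨ R.+-congʳ (R.+-comm 1# k₁) ⟩
        k₁ + 1# + - 1#   ≈⟨ R.+-assoc _ _ _ ⟩
        k₁ + (1# + - 1#) ≈⟨ R.+-congˡ (R.-‿inverseʳ 1#) ⟩
        k₁ + 0#          ≈⟨ R.+-identityʳ _ ⟩
        k₁               ∎

      1<k : 1# < k
      1<k = O.trans (O.reflexive (R.sym (R.+-identityʳ 1#))) (+-monoʳ-≤ 1# k₁≥0)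
          , λ 1≈k → k₁≉0 (R.trans (R.sym k-1≈k₁) (R.trans (R.+-congʳ (R.sym 1≈k)) (R.-‿inverseʳ 1#)))
        where
        S≥0 = +-nonneg 0≤1 4M≥0
        k₁≥0 : 0# ≤ k₁
        k₁≥0 = *-nonneg (*-nonneg S≥0 S≥0) (inverse-nonneg D≥0 D≉0)

      Drr≈ : D * (r * r) ≈ (k - 1#) ⁻¹
      Drr≈ = inverse-unique
        (begin
          (k - 1#) * (D * (r * r))     ≈⟨ R.*-congʳ k-1≈k₁ ⟩
          S * S * D ⁻¹ * (D * (r * r)) ≈⟨ solve 4 (λ s d e r → s :* s :* e :* (d :* (r :* r)) := (s :* r) :* (s :* r) :* (d :* e)) R.refl S D (D ⁻¹) r ⟩
          S * r * (S * r) * (D * D ⁻¹) ≈⟨ R.*-cong (R.*-cong Sr≈1 Sr≈1) (⁻¹-inverseʳ D≉0) ⟩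
          1# * 1# * 1#                 ≈⟨ R.*-congʳ (R.*-identityˡ 1#) ⟩
          1# * 1#                      ≈⟨ R.*-identityˡ 1# ⟩
          1#                           ∎)
        (λ eq → k₁≉0 (R.trans (R.sym k-1≈k₁) eq))

      ψ φ : Fin (suc m) → Vector Carrier (suc m)
      ψ i a = A * δ i a + b
      φ i a = r * ψ i a

      sum-ψ : ∀ i (f : Vector Carrier (suc m)) → ψ i · f ≈ A * f i + b * sum f
      sum-ψ i f = begin
        sum (λ a → (A * δ i a + b) * f a)
          ≈⟨ sum-cong-≋ (λ a → solve 4 (λ A d b f → (A :* d :+ b) :* f := A :* (d :* f) :+ b :* f) R.refl A (δ i a) b (f a)) ⟩
        sum (λ a → A * (δ i a * f a) + b * f a)
          ≈⟨ ∑-distrib-+ (λ a → A * (δ i a * f a)) (λ a → b * f a) ⟩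
        sum (λ a → A * (δ i a * f a)) + sum (λ a → b * f a)
          ≈⟨ R.+-cong (*-distribˡ-sum A (λ a → δ i a * f a)) (*-distribˡ-sum b f) ⟨
        A * sum (λ a → δ i a * f a) + b * sum f
          ≈⟨ R.+-congʳ (R.*-congˡ (sum-δ i f)) ⟩
        A * f i + b * sum f ∎

      sum-ψ1 : ∀ i → sum (ψ i) ≈ A + b * N
      sum-ψ1 i = begin
        sum (ψ i)               ≈⟨ sum-cong-≋ (λ a → R.*-identityʳ (ψ i a)) ⟨
        ψ i · (λ _ → 1#)        ≈⟨ sum-ψ i (λ _ → 1#) ⟩
        A * 1# + b * N          ≈⟨ R.+-congʳ (R.*-identityʳ A) ⟩
        A + b * N               ∎

      X : Carrier
      X = A * b + b * (A + b * N)

      X+D≈0 : X + D ≈ 0#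
      X+D≈0 = begin
        X + D
          ≈⟨ solve 2 (λ M b →
               let 4′ = (con 1 :+ con 1) :+ (con 1 :+ con 1)
                   T′ = con 1 :+ (con 1 :+ 4′ :* M)
                   A′ = con 1 :+ T′
                   N′ = con 1 :+ M
               in (A′ :* b :+ b :* (A′ :+ b :* N′)) :+ 4′ :* T′
                  := (b :+ 4′) :* (N′ :* b :+ T′)) R.refl M b ⟩
        (b + four) * (N * b + T) ≈⟨ R.*-congʳ (R.-‿inverseˡ four) ⟩
        0# * (N * b + T)         ≈⟨ R.zeroˡ _ ⟩
        0#                       ∎

      φ·φ : ∀ i j → φ i · φ j ≈ (A * A * δ j i + X) * (r * r)
      φ·φ i j = begin
        sum (λ a → (r * ψ i a) * (r * ψ j a))
          ≈⟨ sum-cong-≋ (λ a → solve 3 (λ r x y → (r :* x) :* (r :* y) := (r :* r) :* (x :* y)) R.refl r (ψ i a) (ψ j a)) ⟩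
        sum (λ a → r * r * (ψ i a * ψ j a))
          ≈⟨ *-distribˡ-sum (r * r) (λ a → ψ i a * ψ j a) ⟨
        r * r * (ψ i · ψ j)
          ≈⟨ R.*-congˡ (R.trans (sum-ψ i (ψ j)) (R.+-congˡ (R.*-congˡ (sum-ψ1 j)))) ⟩
        r * r * (A * (A * δ j i + b) + b * (A + b * N))
          ≈⟨ solve 5 (λ r A d b s → (r :* r) :* (A :* (A :* d :+ b) :+ b :* s) := (A :* A :* d :+ (A :* b :+ b :* s)) :* (r :* r)) R.refl r A (δ j i) b (A + b * N) ⟩
        (A * A * δ j i + X) * (r * r) ∎

      φ-unit : ∀ i → φ i · φ i ≈ 1#
      φ-unit i = begin
        φ i · φ i                     ≈⟨ φ·φ i i ⟩
        (A * A * δ i i + X) * (r * r) ≈⟨ R.*-congʳ (R.+-congʳ (R.*-congˡ (δ-refl i))) ⟩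
        (A * A * 1# + X) * (r * r)    ≈⟨ R.*-congʳ (solve 2 (λ M X →
               let 4′ = (con 1 :+ con 1) :+ (con 1 :+ con 1)
                   S′ = con 1 :+ 4′ :* M
                   T′ = con 1 :+ S′
                   A′ = con 1 :+ T′
               in A′ :* A′ :* con 1 :+ X := S′ :* S′ :+ (X :+ 4′ :* T′)) R.refl M X) ⟩
        (S * S + (X + D)) * (r * r)   ≈⟨ R.*-congʳ (R.trans (R.+-congˡ X+D≈0) (R.+-identityʳ _)) ⟩
        S * S * (r * r)               ≈⟨ solve 2 (λ s r → s :* s :* (r :* r) := s :* r :* (s :* r)) R.refl S r ⟩
        S * r * (S * r)               ≈⟨ R.*-cong Sr≈1 Sr≈1 ⟩
        1# * 1#                       ≈⟨ R.*-identityˡ 1# ⟩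
        1#                            ∎

      φ-edge : ∀ i j → i ≢ j → φ i · φ j ≈ - (k - 1#) ⁻¹
      φ-edge i j i≢j = begin
        φ i · φ j                     ≈⟨ φ·φ i j ⟩
        (A * A * δ j i + X) * (r * r) ≈⟨ R.*-congʳ (R.+-congʳ (R.trans (R.*-congˡ (δ-≢ j i (i≢j ∘ ≡.sym))) (R.zeroʳ _))) ⟩
        (0# + X) * (r * r)            ≈⟨ R.*-congʳ (R.+-identityˡ X) ⟩
        X * (r * r)                   ≈⟨ R.+-identityʳ _ ⟨
        X * (r * r) + 0#              ≈⟨ R.+-congˡ (R.-‿inverseʳ (D * (r * r))) ⟨
        X * (r * r) + (D * (r * r) + - (D * (r * r)))
          ≈⟨ solve 4 (λ x d q e → x :* q :+ (d :* q :+ e) := (x :+ d) :* q :+ e) R.refl X D (r * r) (- (D * (r * r))) ⟩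
        (X + D) * (r * r) + - (D * (r * r)) ≈⟨ R.+-congʳ (R.trans (R.*-congʳ X+D≈0) (R.zeroˡ _)) ⟩
        0# + - (D * (r * r))          ≈⟨ R.+-identityˡ _ ⟩
        - (D * (r * r))               ≈⟨ R.-‿cong Drr≈ ⟩
        - (k - 1#) ⁻¹                 ∎

  strictVectorColorable : ∀ G → ∃ (StrictVectorColorable G)
  strictVectorColorable G = go (Graph.order G) (Graph.finite G)
    where
    open Graph G
    go : ∀ n → V ↔ Fin n → ∃ (StrictVectorColorable G)
    go zero    f with () ← Inverse.to f vertex
    go (suc m) f = k , 1<k , suc m , φ ∘ to , record
      { unit = φ-unit ∘ to
      ; edge = λ u~v → φ-edge _ _ (λ eq → ~-irrefl (injective eq) u~v)
      }
      where
      open Simplex m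
      open Inverse f using (to)
      open Injection (↔⇒↣ f) using (injective)

  ϑ̄-infimum : ∀ G → ∃ (IsInfimum (StrictVectorColorable G))
  ϑ̄-infimum G = infimum (StrictVectorColorable G) (strictVectorColorable G)
                  (1# , λ ((1≤k , _) , _) → 1≤k)

  ϑ̄ : Graph → Carrier
  ϑ̄ G = proj₁ (ϑ̄-infimum G)

{-# OPTIONS --safe #-}

-- If φ and ψ are strict vector k-colorings of G and H, then
-- (u , v) ↦ φ u ⊗ ψ v is one of G □ H, and a coloring of G □ H restricts to
-- the fibres G × {v} and {u} × H.  So G □ H is k-colorable exactly when both
-- factors are.  Prepending a constant coordinate to a rescaled k-coloring gives
-- a k′-coloring for each k′ ≥ k, so the sets of admissible k are closed upwards
-- and the infimum of the intersection is the maximum of the infima.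

module Submission where

open import Defs

open import Algebra.Bundles using (CommutativeRing)
import Algebra.Construct.NaturalChoice.Max as Max
import Algebra.Properties.AbelianGroup as AbelianGroupProperties
import Algebra.Properties.Ring as RingProperties
import Algebra.Properties.Semiring.Sum as Sum
import Algebra.Solver.Ring.NaturalCoefficients.Default as Solver
open import Data.Fin.Base using (zero; suc; _↑ˡ_; _↑ʳ_; combine; quotient; remainder)
open import Data.Fin.Properties using (remQuot-combine)
open import Data.Nat.Base using (zero; suc) renaming (_+_ to _+ⁿ_; _*_ to _*ⁿ_)
open import Data.Product.Base using (∃-syntax; _×_; _,_; proj₁; proj₂)
open import Data.Sum.Base using (inj₁; inj₂)
open import Data.Vec.Functional using (Vector; _∷_; map)
open import Function.Base using (_∘_)
open import Level using (Lift; lift) renaming (_⊔_ to _⊔ˡ_)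
open import Relation.Binary.Bundles using (DecTotalOrder)
import Relation.Binary.Construct.NonStrictToStrict as NonStrictToStrict
open import Relation.Binary.PropositionalEquality.Core as ≡ using (_≡_)
import Relation.Binary.Reasoning.PartialOrder as ≤-Reasoning
import Relation.Binary.Reasoning.Setoid as ≈-Reasoning
open import Relation.Nullary.Decidable using (yes; no)
open import Relation.Nullary.Negation using (¬_; contradiction)
open import Relation.Unary using (Pred; _∈_)

-- Inequalities and inverses in the ordered field.

module OrderedField {c ℓ₁ ℓ₂} (ℝ : CompleteOrderedField c ℓ₁ ℓ₂) where

  open CompleteOrderedField ℝ
  private
    module R = CommutativeRing commutativeRing
    module O = DecTotalOrder decTotalOrder
  open RingProperties R.ring using (-‿distribˡ-*; -‿distribʳ-*; -‿involutive; +-cancelʳ)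
  open AbelianGroupProperties R.+-abelianGroup using (xyx⁻¹≈y)
  open Solver R.commutativeSemiring using (solve; con; _:=_; _:+_; _:*_)
  open ≤-Reasoning O.poset

  +-monoˡ-≤ : ∀ z {x y} → x ≤ y → x + z ≤ y + z
  +-monoˡ-≤ z {x} {y} x≤y = begin
    x + z ≈⟨ R.+-comm x z ⟩
    z + x ≤⟨ +-monoʳ-≤ z x≤y ⟩
    z + y ≈⟨ R.+-comm z y ⟩
    y + z ∎

  x≤x+y : ∀ {x y} → 0# ≤ y → x ≤ x + y
  x≤x+y {x} {y} 0≤y = begin
    x      ≈⟨ R.+-identityʳ x ⟨
    x + 0# ≤⟨ +-monoʳ-≤ x 0≤y ⟩
    x + y  ∎

  +-nonneg : ∀ {x y} → 0# ≤ x → 0# ≤ y → 0# ≤ x + y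
  +-nonneg 0≤x 0≤y = O.trans 0≤x (x≤x+y 0≤y)

  x+[y-x]≈y : ∀ x y → x + (y - x) ≈ y
  x+[y-x]≈y x y = R.trans (R.sym (R.+-assoc x y (- x))) (xyx⁻¹≈y x y)

  x≤y⇒0≤y-x : ∀ {x y} → x ≤ y → 0# ≤ y - x
  x≤y⇒0≤y-x {x} {y} x≤y = begin
    0#    ≈⟨ R.-‿inverseʳ x ⟨
    x - x ≤⟨ +-monoˡ-≤ (- x) x≤y ⟩
    y - x ∎

  *-monoˡ-≤ : ∀ {x y z} → 0# ≤ z → x ≤ y → z * x ≤ z * y
  *-monoˡ-≤ {x} {y} {z} 0≤z x≤y = begin
    z * x               ≤⟨ x≤x+y (*-nonneg 0≤z (x≤y⇒0≤y-x x≤y)) ⟩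
    z * x + z * (y - x) ≈⟨ R.distribˡ z x (y - x) ⟨
    z * (x + (y - x))   ≈⟨ R.*-congˡ (x+[y-x]≈y x y) ⟩
    z * y               ∎

  square-mono-≤ : ∀ {x y} → 0# ≤ x → x ≤ y → x * x ≤ y * y
  square-mono-≤ {x} {y} 0≤x x≤y = begin
    x * x ≤⟨ *-monoˡ-≤ 0≤x x≤y ⟩
    x * y ≈⟨ R.*-comm x y ⟩
    y * x ≤⟨ *-monoˡ-≤ (O.trans 0≤x x≤y) x≤y ⟩
    y * y ∎

  0≤x*x : ∀ x → 0# ≤ x * x
  0≤x*x x with O.total 0# x
  ... | inj₁ 0≤x = *-nonneg 0≤x 0≤x
  ... | inj₂ x≤0 = begin
    0#             ≤⟨ *-nonneg 0≤-x 0≤-x ⟩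
    - x * - x      ≈⟨ -‿distribˡ-* x (- x) ⟨
    - (x * - x)    ≈⟨ R.-‿cong (-‿distribʳ-* x x) ⟨
    - (- (x * x))  ≈⟨ -‿involutive (x * x) ⟩
    x * x          ∎
    where
    0≤-x : 0# ≤ - x
    0≤-x = O.trans (x≤y⇒0≤y-x x≤0) (O.reflexive (R.+-identityˡ (- x)))

  0≤1 : 0# ≤ 1#
  0≤1 = O.trans (0≤x*x 1#) (O.reflexive (R.*-identityˡ 1#))

  1+x≉0 : ∀ {x} → 0# ≤ x → ¬ (1# + x ≈ 0#)
  1+x≉0 0≤x 1+x≈0 = 0≉1 (O.antisym 0≤1 (O.trans (x≤x+y 0≤x) (O.reflexive 1+x≈0)))

  -- `x ⁻¹` equals `x` times the square of `x ⁻¹`, a product of nonnegative factors.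
  ⁻¹-nonneg : ∀ {x} → 0# ≤ x → ¬ (x ≈ 0#) → 0# ≤ x ⁻¹
  ⁻¹-nonneg {x} 0≤x x≉0 = begin
    0#                   ≤⟨ *-nonneg 0≤x (0≤x*x (x ⁻¹)) ⟩
    x * (x ⁻¹ * x ⁻¹)    ≈⟨ R.*-assoc x (x ⁻¹) (x ⁻¹) ⟨
    x * x ⁻¹ * x ⁻¹      ≈⟨ R.*-congʳ (⁻¹-inverseʳ x≉0) ⟩
    1# * x ⁻¹            ≈⟨ R.*-identityˡ (x ⁻¹) ⟩
    x ⁻¹                 ∎

  1<x⇒0≤x-1 : ∀ {x} → 1# < x → 0# ≤ x - 1#
  1<x⇒0≤x-1 (1≤x , _) = x≤y⇒0≤y-x 1≤x

  1<x⇒x-1≉0 : ∀ {x} → 1# < x → ¬ (x - 1# ≈ 0#)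
  1<x⇒x-1≉0 {x} (_ , 1≉x) x-1≈0 = 1≉x (begin-equality
    1#             ≈⟨ R.+-identityʳ 1# ⟨
    1# + 0#        ≈⟨ R.+-congˡ x-1≈0 ⟨
    1# + (x - 1#)  ≈⟨ x+[y-x]≈y 1# x ⟩
    x              ∎)

  -- Square roots in the unit interval.

  ½ : Carrier
  ½ = (1# + 1#) ⁻¹

  0≤½ : 0# ≤ ½
  0≤½ = ⁻¹-nonneg (+-nonneg 0≤1 0≤1) (1+x≉0 0≤1)

  2*½≈1 : (1# + 1#) * ½ ≈ 1#
  2*½≈1 = ⁻¹-inverseʳ (1+x≉0 0≤1)

  -- The root is 1 - z for the least fixed point z of z ↦ (b + z²) / 2, an
  -- increasing map on the nonnegative numbers.
  √ : ∀ {a b} → 0# ≤ a → 0# ≤ b → a + b ≈ 1# → ∃[ s ] s * s ≈ a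
  √ {a} {b} 0≤a 0≤b a+b≈1 with infimum S (1# , 1∈S) (0# , λ (lift (0≤z , _)) → 0≤z)
    where
    S : Pred Carrier (c ⊔ˡ ℓ₁ ⊔ˡ ℓ₂)
    -- The nonnegative points that the map does not increase, as in the Knaster-Tarski theorem.
    -- `Lift` adjusts the universe level to the one that `infimum` takes.
    S z = Lift (c ⊔ˡ ℓ₁) (0# ≤ z × ½ * (b + z * z) ≤ z)

    1∈S : 1# ∈ S
    1∈S = lift (0≤1 , (begin
      -- The map sends 1 to `1 - a / 2`, so adding `½ * a` brings it back to 1.
      ½ * (b + 1# * 1#)           ≤⟨ x≤x+y (*-nonneg 0≤½ 0≤a) ⟩
      ½ * (b + 1# * 1#) + ½ * a   ≈⟨ solve 3 (λ h a b → h :* (b :+ con 1 :* con 1) :+ h :* a := h :* (con 1 :+ (a :+ b))) R.refl ½ a b ⟩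
      ½ * (1# + (a + b))          ≈⟨ R.*-congˡ (R.+-congˡ a+b≈1) ⟩
      ½ * (1# + 1#)               ≈⟨ R.*-comm ½ (1# + 1#) ⟩
      (1# + 1#) * ½               ≈⟨ 2*½≈1 ⟩
      1#                          ∎))
  -- With `b` and `z * z` added to both sides, and `2z` made quadratic through `z + s ≈ 1#`, the
  -- claim rests on an identity of commutative semirings.
  ... | z , lower , greatest = 1# - z , +-cancelʳ b _ _ (+-cancelʳ (z * z) _ _ (begin-equality
    s * s + b + z * z           ≈⟨ R.+-assoc (s * s) b (z * z) ⟩
    s * s + (b + z * z)         ≈⟨ R.+-congˡ 2z≈b+z² ⟨
    s * s + (1# + 1#) * z       ≈⟨ R.+-congˡ (R.*-congˡ (R.*-identityʳ z)) ⟨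
    s * s + (1# + 1#) * (z * 1#) ≈⟨ R.+-congˡ (R.*-congˡ (R.*-congˡ z+s≈1)) ⟨
    s * s + (1# + 1#) * (z * (z + s))
      ≈⟨ solve 2 (λ s z → s :* s :+ con 2 :* (z :* (z :+ s)) := (z :+ s) :* (z :+ s) :+ z :* z) R.refl s z ⟩
    (z + s) * (z + s) + z * z   ≈⟨ R.+-congʳ (R.*-cong z+s≈1 z+s≈1) ⟩
    1# * 1# + z * z             ≈⟨ R.+-congʳ (R.*-identityˡ 1#) ⟩
    1# + z * z                  ≈⟨ R.+-congʳ a+b≈1 ⟨
    a + b + z * z               ∎))
    where
    s : Carrier
    s = 1# - z

    z+s≈1 : z + s ≈ 1#
    z+s≈1 = x+[y-x]≈y z 1#

    g : Carrier → Carrier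
    g x = ½ * (b + x * x)

    g-mono : ∀ {x y} → 0# ≤ x → x ≤ y → g x ≤ g y
    g-mono 0≤x x≤y = *-monoˡ-≤ 0≤½ (+-monoʳ-≤ b (square-mono-≤ 0≤x x≤y))

    0≤z : 0# ≤ z
    0≤z = greatest λ (lift (0≤x , _)) → 0≤x

    gz≤z : g z ≤ z
    -- By monotonicity `g z ≤ g x ≤ x` for every `x` in `S`, so `g z` is a lower bound.
    gz≤z = greatest λ x∈S@(lift (0≤x , gx≤x)) → O.trans (g-mono 0≤z (lower x∈S)) gx≤x

    0≤gz : 0# ≤ g z
    0≤gz = *-nonneg 0≤½ (+-nonneg 0≤b (0≤x*x z))

    z≤gz : z ≤ g z
    -- Applying `g` to `gz≤z` shows that `g z` itself lies in `S`.
    z≤gz = lower (lift (0≤gz , g-mono 0≤gz gz≤z))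

    2z≈b+z² : (1# + 1#) * z ≈ b + z * z
    2z≈b+z² = begin-equality
      (1# + 1#) * z                   ≈⟨ R.*-congˡ (O.antisym z≤gz gz≤z) ⟩
      (1# + 1#) * (½ * (b + z * z))   ≈⟨ R.*-assoc (1# + 1#) ½ (b + z * z) ⟨
      (1# + 1#) * ½ * (b + z * z)     ≈⟨ R.*-congʳ 2*½≈1 ⟩
      1# * (b + z * z)                ≈⟨ R.*-identityˡ (b + z * z) ⟩
      b + z * z                       ∎

module Colorings {c ℓ₁ ℓ₂} (ℝ : CompleteOrderedField c ℓ₁ ℓ₂) where

  open CompleteOrderedField ℝ
  open Theta ℝ
  open OrderedField ℝ
  private
    module R = CommutativeRing commutativeRing
    module O = DecTotalOrder decTotalOrder
  open RingProperties R.ring using (-‿distribʳ-*; +-cancelʳ)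
  open Sum R.semiring using (sum; sum-cong-≋; *-distribˡ-sum; *-distribʳ-sum)
  open Solver R.commutativeSemiring using (solve; con; _:=_; _:+_; _:*_)
  open Max totalOrder using (x≤y⇒x≤y⊔z; x≤y⇒x≤z⊔y)
  open ≈-Reasoning R.setoid

  -- Inner products of tensor products and of rescaled vectors.

  sum-↑ : ∀ m {n} (f : Vector Carrier (m +ⁿ n)) →
          sum f ≈ sum (f ∘ (_↑ˡ n)) + sum (f ∘ (m ↑ʳ_))
  sum-↑ zero    f = R.sym (R.+-identityˡ (sum f))
  sum-↑ (suc m) f = R.trans (R.+-congˡ (sum-↑ m (f ∘ suc))) (R.sym (R.+-assoc _ _ _))

  sum-combine : ∀ m {n} (f : Vector Carrier (m *ⁿ n)) →
                sum f ≈ sum (λ i → sum (λ j → f (combine {m} i j)))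
  sum-combine zero        f = R.refl
  sum-combine (suc m) {n} f =
    R.trans (sum-↑ n f) (R.+-congˡ (sum-combine m (f ∘ (n ↑ʳ_))))

  infixl 7 _⊗_

  -- The Kronecker product. `quotient` and `remainder` invert `combine`, which is the indexing that
  -- `sum-combine` uses.
  _⊗_ : ∀ {m n} → Vector Carrier m → Vector Carrier n → Vector Carrier (m *ⁿ n)
  (_⊗_ {m} {n} x y) i = x (quotient {m} n i) * y (remainder {m} n i)

  ⊗-combine : ∀ {m n} (x : Vector Carrier m) (y : Vector Carrier n) i j →
              (x ⊗ y) (combine i j) ≡ x i * y j
  ⊗-combine x y i j = ≡.cong (λ (a , b) → x a * y b) (remQuot-combine i j)

  -- After reindexing by pairs, each summand is a function of `i` times a function of `j`, so the
  -- double sum factors.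
  ⊗-·-⊗ : ∀ {m n} (x x′ : Vector Carrier m) (y y′ : Vector Carrier n) →
          (x ⊗ y) · (x′ ⊗ y′) ≈ (x · x′) * (y · y′)
  ⊗-·-⊗ {m} {n} x x′ y y′ = begin
    (x ⊗ y) · (x′ ⊗ y′)
      ≈⟨ sum-combine m {n} _ ⟩
    sum (λ i → sum (λ j → (x ⊗ y) (combine {m} {n} i j) * (x′ ⊗ y′) (combine {m} {n} i j)))
      ≈⟨ sum-cong-≋ (λ i → sum-cong-≋ (λ j → R.trans
           (R.*-cong (R.reflexive (⊗-combine x y i j)) (R.reflexive (⊗-combine x′ y′ i j)))
           (solve 4 (λ a b a′ b′ → (a :* b) :* (a′ :* b′) := (a :* a′) :* (b :* b′)) R.refl (x i) (y j) (x′ i) (y′ j)))) ⟩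
    sum (λ i → sum (λ j → (x i * x′ i) * (y j * y′ j)))
      ≈⟨ sum-cong-≋ (λ i → *-distribˡ-sum (x i * x′ i) (λ j → y j * y′ j)) ⟨
    sum (λ i → (x i * x′ i) * (y · y′))
      ≈⟨ *-distribʳ-sum (y · y′) (λ i → x i * x′ i) ⟨
    (x · x′) * (y · y′) ∎

  map*-·-map* : ∀ a {d} (x y : Vector Carrier d) →
                map (a *_) x · map (a *_) y ≈ a * a * (x · y)
  map*-·-map* a x y = begin
    sum (λ i → (a * x i) * (a * y i))
      ≈⟨ sum-cong-≋ (λ i → solve 3 (λ a x y → (a :* x) :* (a :* y) := (a :* a) :* (x :* y)) R.refl a (x i) (y i)) ⟩
    sum (λ i → a * a * (x i * y i))
      ≈⟨ *-distribˡ-sum (a * a) (λ i → x i * y i) ⟨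
    a * a * (x · y) ∎

  -- Colorings of the product and of its fibres.

  -- An edge of the product moves only one coordinate. The fixed coordinate contributes the factor
  -- 1, and the moving one the prescribed inner product.
  □-colorable : ∀ G H {k} → StrictVectorColorable G k → StrictVectorColorable H k →
                StrictVectorColorable (G □ H) k
  □-colorable G H {k} (1<k , d , φ , φ-coloring) (_ , e , ψ , ψ-coloring) =
    1<k , d *ⁿ e , (λ (u , v) → φ u ⊗ ψ v) , record
      { unit = λ (u , v) → begin
          (φ u ⊗ ψ v) · (φ u ⊗ ψ v) ≈⟨ ⊗-·-⊗ (φ u) (φ u) (ψ v) (ψ v) ⟩
          (φ u · φ u) * (ψ v · ψ v) ≈⟨ R.*-cong (Φ.unit u) (Ψ.unit v) ⟩
          1# * 1#                   ≈⟨ R.*-identityˡ 1# ⟩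
          1#                        ∎
      ; edge = □-edge
      }
    where
    module Φ = IsStrictVectorColoring φ-coloring
    module Ψ = IsStrictVectorColoring ψ-coloring

    □-edge : ∀ {w w′} → Graph._~_ (G □ H) w w′ →
             (φ (proj₁ w) ⊗ ψ (proj₂ w)) · (φ (proj₁ w′) ⊗ ψ (proj₂ w′)) ≈ - (k - 1#) ⁻¹
    □-edge {u , v} {u′ , _} (inj₁ (u~u′ , ≡.refl)) = begin
      (φ u ⊗ ψ v) · (φ u′ ⊗ ψ v) ≈⟨ ⊗-·-⊗ (φ u) (φ u′) (ψ v) (ψ v) ⟩
      (φ u · φ u′) * (ψ v · ψ v) ≈⟨ R.*-cong (Φ.edge u~u′) (Ψ.unit v) ⟩
      - (k - 1#) ⁻¹ * 1#         ≈⟨ R.*-identityʳ _ ⟩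
      - (k - 1#) ⁻¹              ∎
    □-edge {u , v} {_ , v′} (inj₂ (≡.refl , v~v′)) = begin
      (φ u ⊗ ψ v) · (φ u ⊗ ψ v′) ≈⟨ ⊗-·-⊗ (φ u) (φ u) (ψ v) (ψ v′) ⟩
      (φ u · φ u) * (ψ v · ψ v′) ≈⟨ R.*-cong (Φ.unit u) (Ψ.edge v~v′) ⟩
      1# * - (k - 1#) ⁻¹         ≈⟨ R.*-identityˡ _ ⟩
      - (k - 1#) ⁻¹              ∎

  -- The chosen vertex of `H`, available because graphs are nonempty, picks out a copy of `G` inside
  -- the product.
  □-colorableˡ : ∀ G H {k} → StrictVectorColorable (G □ H) k → StrictVectorColorable G k
  □-colorableˡ G H (1<k , d , χ , χ-coloring) =
    1<k , d , (λ u → χ (u , Graph.vertex H)) , record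
      { unit = λ u → unit (u , Graph.vertex H)
      ; edge = λ u~u′ → edge (inj₁ (u~u′ , ≡.refl))
      }
    where open IsStrictVectorColoring χ-coloring

  □-colorableʳ : ∀ G H {k} → StrictVectorColorable (G □ H) k → StrictVectorColorable H k
  □-colorableʳ G H (1<k , d , χ , χ-coloring) =
    1<k , d , (λ v → χ (Graph.vertex G , v)) , record
      { unit = λ v → unit (Graph.vertex G , v)
      ; edge = λ v~v′ → edge (inj₂ (≡.refl , v~v′))
      }
    where open IsStrictVectorColoring χ-coloring

  -- Upward closure of the admissible numbers.

  -- With t = 1/(k-1) and t′ = 1/(k′-1), the new coordinate b and the scaling
  -- factor a must satisfy a² + b² = 1 and b² - a² t = - t′.
  colorable-mono : ∀ G {k k′} → k ≤ k′ → StrictVectorColorable G k → StrictVectorColorable G k′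
  colorable-mono G {k} {k′} k≤k′ (1<k , d , φ , φ-coloring) =
    1<k′ , suc d , (λ u → b ∷ map (a *_) (φ u)) , record
      { unit = λ u → begin
          b * b + map (a *_) (φ u) · map (a *_) (φ u) ≈⟨ R.+-cong b²≈β (map*-·-map* a (φ u) (φ u)) ⟩
          β + a * a * (φ u · φ u)                     ≈⟨ R.+-congˡ (R.*-cong a²≈α (unit u)) ⟩
          β + α * 1#                                  ≈⟨ R.+-congˡ (R.*-identityʳ α) ⟩
          β + α                                       ≈⟨ R.+-comm β α ⟩
          α + β                                       ≈⟨ α+β≈1 ⟩
          1#                                          ∎
      ; edge = λ {u} {v} u~v → begin
          b * b + map (a *_) (φ u) · map (a *_) (φ v) ≈⟨ R.+-cong b²≈β (map*-·-map* a (φ u) (φ v)) ⟩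
          β + a * a * (φ u · φ v)                     ≈⟨ R.+-congˡ (R.*-cong a²≈α (edge u~v)) ⟩
          β + α * - t                                 ≈⟨ β-αt≈-t′ ⟩
          - t′                                        ∎
      }
    where
    open IsStrictVectorColoring φ-coloring

    1<k′ : 1# < k′
    1<k′ = NonStrictToStrict.<-≤-trans _≈_ _≤_ R.sym O.trans O.antisym O.≤-respʳ-≈ 1<k k≤k′

    p p′ e t t′ r v α β : Carrier
    p = k - 1#
    p′ = k′ - 1#
    e = k′ - k
    t = p ⁻¹
    t′ = p′ ⁻¹
    -- This is `t - t′`, written as `(p′ - p) / (p p′)` so that it is visibly nonnegative.
    r = t * e * t′
    v = (1# + t) ⁻¹
    -- Solving the two linear conditions on `a²` and `b²` gives `α = (1 + t′) / (1 + t)` and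
    -- `β = (t - t′) / (1 + t)`.
    α = (1# + t′) * v
    β = r * v

    0≤t : 0# ≤ t
    0≤t = ⁻¹-nonneg (1<x⇒0≤x-1 1<k) (1<x⇒x-1≉0 1<k)

    0≤t′ : 0# ≤ t′
    0≤t′ = ⁻¹-nonneg (1<x⇒0≤x-1 1<k′) (1<x⇒x-1≉0 1<k′)

    0≤v : 0# ≤ v
    0≤v = ⁻¹-nonneg (+-nonneg 0≤1 0≤t) (1+x≉0 0≤t)

    0≤α : 0# ≤ α
    0≤α = *-nonneg (+-nonneg 0≤1 0≤t′) 0≤v

    0≤β : 0# ≤ β
    0≤β = *-nonneg (*-nonneg (*-nonneg 0≤t (x≤y⇒0≤y-x k≤k′)) 0≤t′) 0≤v

    p+e≈p′ : p + e ≈ p′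
    p+e≈p′ = begin
      k + - 1# + e   ≈⟨ solve 3 (λ k m e → k :+ m :+ e := k :+ e :+ m) R.refl k (- 1#) e ⟩
      k + e + - 1#   ≈⟨ R.+-congʳ (x+[y-x]≈y k k′) ⟩
      p′             ∎

    t≈t′+r : t ≈ t′ + r
    t≈t′+r = begin
      t                             ≈⟨ R.*-identityʳ t ⟨
      t * 1#                        ≈⟨ R.*-congˡ (⁻¹-inverseʳ (1<x⇒x-1≉0 1<k′)) ⟨
      t * (p′ * t′)                 ≈⟨ R.*-congˡ (R.*-congʳ p+e≈p′) ⟨
      t * ((p + e) * t′)            ≈⟨ solve 4 (λ t p e t′ → t :* ((p :+ e) :* t′) := p :* t :* t′ :+ t :* e :* t′) R.refl t p e t′ ⟩
      p * t * t′ + r                ≈⟨ R.+-congʳ (R.*-congʳ (⁻¹-inverseʳ (1<x⇒x-1≉0 1<k))) ⟩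
      1# * t′ + r                   ≈⟨ R.+-congʳ (R.*-identityˡ t′) ⟩
      t′ + r                        ∎

    α+β≈1 : α + β ≈ 1#
    α+β≈1 = begin
      (1# + t′) * v + r * v   ≈⟨ solve 3 (λ t′ r v → (con 1 :+ t′) :* v :+ r :* v := (con 1 :+ (t′ :+ r)) :* v) R.refl t′ r v ⟩
      (1# + (t′ + r)) * v     ≈⟨ R.*-congʳ (R.+-congˡ t≈t′+r) ⟨
      (1# + t) * v            ≈⟨ ⁻¹-inverseʳ (1+x≉0 0≤t) ⟩
      1#                      ∎

    β+t′≈αt : β + t′ ≈ α * t
    β+t′≈αt = begin
      β + t′                       ≈⟨ R.+-congˡ (R.*-identityʳ t′) ⟨
      -- Writing 1 as `α + β` gives every term the factor `v`, and a semiring identity finishes the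
      -- regrouping.
      β + t′ * 1#                  ≈⟨ R.+-congˡ (R.*-congˡ α+β≈1) ⟨
      r * v + t′ * ((1# + t′) * v + r * v)
        ≈⟨ solve 3 (λ r t′ v → r :* v :+ t′ :* ((con 1 :+ t′) :* v :+ r :* v) := (con 1 :+ t′) :* v :* (t′ :+ r)) R.refl r t′ v ⟩
      α * (t′ + r)                 ≈⟨ R.*-congˡ t≈t′+r ⟨
      α * t                        ∎

    β-αt≈-t′ : β + α * - t ≈ - t′
    β-αt≈-t′ = +-cancelʳ t′ _ _ (begin
      β + α * - t + t′      ≈⟨ solve 3 (λ x y z → x :+ y :+ z := x :+ z :+ y) R.refl β (α * - t) t′ ⟩
      β + t′ + α * - t      ≈⟨ R.+-cong β+t′≈αt (R.sym (-‿distribʳ-* α t)) ⟩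
      α * t - α * t         ≈⟨ R.-‿inverseʳ (α * t) ⟩
      0#                    ≈⟨ R.-‿inverseˡ t′ ⟨
      - t′ + t′             ∎)

    a b : Carrier
    -- `α` and `β` are nonnegative with sum 1, so each certifies that the other lies in the unit
    -- interval, where `√` applies.
    a = proj₁ (√ 0≤α 0≤β α+β≈1)
    b = proj₁ (√ 0≤β 0≤α (R.trans (R.+-comm β α) α+β≈1))

    a²≈α : a * a ≈ α
    a²≈α = proj₂ (√ 0≤α 0≤β α+β≈1)

    b²≈β : b * b ≈ β
    b²≈β = proj₂ (√ 0≤β 0≤α (R.trans (R.+-comm β α) α+β≈1))

  -- Comparison of the infima.

  ϑ̄-lower : ∀ G → IsLowerBound (StrictVectorColorable G) (ϑ̄ G)
  ϑ̄-lower G = proj₁ (proj₂ (ϑ̄-infimum G))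

  ϑ̄-greatest : ∀ G {x} → IsLowerBound (StrictVectorColorable G) x → x ≤ ϑ̄ G
  ϑ̄-greatest G = proj₂ (proj₂ (ϑ̄-infimum G))

  ϑ̄G≤ϑ̄[G□H] : ∀ G H → ϑ̄ G ≤ ϑ̄ (G □ H)
  ϑ̄G≤ϑ̄[G□H] G H = ϑ̄-greatest (G □ H) (ϑ̄-lower G ∘ □-colorableˡ G H)

  ϑ̄H≤ϑ̄[G□H] : ∀ G H → ϑ̄ H ≤ ϑ̄ (G □ H)
  ϑ̄H≤ϑ̄[G□H] G H = ϑ̄-greatest (G □ H) (ϑ̄-lower H ∘ □-colorableʳ G H)

  -- Let `s = ϑ̄ (G □ H)`. If `k` is admissible for `G` and `l` for `H`, the larger of them is
  -- admissible for the product, hence at least `s`. If some such `l` lies below `s`, then every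
  -- such `k` is at least `s`, so `s ≤ ϑ̄ G`; otherwise `s ≤ ϑ̄ H`.
  ϑ̄[G□H]≤ϑ̄G⊔ϑ̄H : ∀ G H → ϑ̄ (G □ H) ≤ ϑ̄ G ⊔ ϑ̄ H
  ϑ̄[G□H]≤ϑ̄G⊔ϑ̄H G H with ϑ̄ (G □ H) O.≤? ϑ̄ G
  ... | yes s≤ϑ̄G = x≤y⇒x≤y⊔z (ϑ̄ H) s≤ϑ̄G
  ... | no  s≰ϑ̄G = x≤y⇒x≤z⊔y (ϑ̄ G) (ϑ̄-greatest H s≤l)
    where
    s : Carrier
    s = ϑ̄ (G □ H)

    s≤l : IsLowerBound (StrictVectorColorable H) s
    s≤l {l} l∈H with s O.≤? l
    ... | yes s≤l = s≤l
    ... | no  s≰l = contradiction (ϑ̄-greatest G s≤k) s≰ϑ̄G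
      where
      s≤k : IsLowerBound (StrictVectorColorable G) s
      s≤k {k} k∈G with O.total k l
      -- Raising `k` to `l` would give `s ≤ l`, contrary to the choice of `l`.
      ... | inj₁ k≤l = contradiction (ϑ̄-lower (G □ H) (□-colorable G H (colorable-mono G k≤l k∈G) l∈H)) s≰l
      -- Raising `l` to `k` gives the desired `s ≤ k`.
      ... | inj₂ l≤k = ϑ̄-lower (G □ H) (□-colorable G H k∈G (colorable-mono H l≤k l∈H))

theorem4p2 : ∀ {c ℓ₁ ℓ₂} (ℝ : CompleteOrderedField c ℓ₁ ℓ₂) →
    let open CompleteOrderedField ℝ
        open Theta ℝ
    in (G H : Graph) → ϑ̄ (G □ H) ≈ ϑ̄ G ⊔ ϑ̄ H
theorem4p2 ℝ G H = antisym (ϑ̄[G□H]≤ϑ̄G⊔ϑ̄H G H) (⊔-lub (ϑ̄G≤ϑ̄[G□H] G H) (ϑ̄H≤ϑ̄[G□H] G H))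
  where
  open CompleteOrderedField ℝ
  open Colorings ℝ
  open DecTotalOrder decTotalOrder using (antisym)
  open Max totalOrder using (⊔-lub)
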